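{- Let $X, Y \subseteq \omega$. Suppose $\mathcal{A}$ is a $Y$-computable combinatory algebra, and that $f:\mathcal{K}_1^X\hookrightarrow \mathcal{A}$ is a weak embedding. Then $X <_T Y$ (that is, $X \leq_T Y$ and $Y \not\leq_T X$).
   Context: A partial applicative structure (pas) is a set $\mathcal{A}$ with a partial binary operation $(a,b)\mapsto a\cdot b=ab$, called application, associating to the left; $ab\downarrow$ means that $ab$ is defined. Application is strict: a compound term $t_1t_2$ is defined only if $t_1$ and $t_2$ are both defined. For closed terms, $t\simeq s$ means that either both are undefined, or both are defined and equal. A pas is a partial combinatory algebra (pca) if it has elements $k,s$ (combinators) such that for all $a,b,c\in\mathcal{A}$: $ka\downarrow$ and $kab=a$; $sab\downarrow$ and $sabc\simeq ac(bc)$. (This is equivalent to combinatory completeness.) A combinatory algebra is a pca whose application is total. All pcas are assumed nontrivial, i.e. to have more than one element. $\mathcal{K}_1^X$ (Kleene's first model relativized to the oracle $X$) is the pca on $\omega$ with application $n\cdot m=\varphi^X_n(m)$, where $\varphi^X_n$ is the $n$-th partial $X$-computable function. A combinatory algebra $\mathcal{A}$ is $Y$-computable if there are a surjection (numbering) $\gamma:\omega\to\mathcal{A}$ and a total $Y$-computable function $\psi:\omega^2\to\omega$ such that $\gamma(n)\cdot\gamma(m)=\gamma(\psi(n,m))$ for all $n,m$, and such that the set $\{(n,m)\mid\gamma(n)=\gamma(m)\}$ is $Y$-computable. (No effectivity is required of $\gamma$ itself.) A weak embedding of a pca $\mathcal{A}$ into a pca $\mathcal{B}$ (written $\mathcal{A}\hookrightarrow\mathcal{B}$)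 is an injection $f:\mathcal{A}\to\mathcal{B}$ such that for all $a,b\in\mathcal{A}$, if $ab$ is defined in $\mathcal{A}$, then $f(a)f(b)$ is defined in $\mathcal{B}$ and equals $f(ab)$. -}

module Defs where

open import Level using (Level; _⊔_; 0ℓ) renaming (suc to lsuc)
open import Data.Nat.Base using (ℕ; zero; suc; _<_)
open import Data.Nat.DivMod using (_mod_)
open import Data.Nat.Properties using (<-cmp; 0≢1+n; 1+n≢0)
open import Data.Fin.Base using (Fin)
open import Data.Vec.Base using (Vec; []; _∷_; lookup)
open import Data.Product.Base using (∃; ∃₂; _×_; _,_; proj₁; proj₂)
open import Function.Bundles using (_⇔_; Injection; Surjection)
open import Relation.Binary.Bundles using (Setoid)
open import Relation.Binary.Definitions using (tri<; tri≈; tri>)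
open import Relation.Binary.PropositionalEquality using (_≡_; refl; trans; sym; setoid)
open import Relation.Nullary using (¬_; contradiction)
open import Relation.Unary using (Pred)

private variable
  a ℓ p : Level
  m n : ℕ

-- The graph of the characteristic function of P. Since it is a relation rather
-- than a Boolean function, P need not be decidable in Agda: subsets of ω are
-- arbitrary predicates on ℕ.

data χ {A : Set a} (P : Pred A p) (x : A) : ℕ → Set (a ⊔ p) where
  in-set  :   P x → χ P x 1
  out-set : ¬ P x → χ P x 0

-- Codes for the n-ary partial recursive functions relative to an oracle.

data Code : ℕ → Set where
  zero   : Code n
  succ   : Code 1
  oracle : Code 1
  proj   : Fin n → Code n
  comp   : Code m → Vec (Code n) m → Code n
  prec   : Code n → Code (suc (suc n)) → Code (suc n)
  mu     : Code (suc n) → Code n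

-- X ⊢ c [ xs ]⇓ y : with oracle X, the function coded by c is defined at xs
-- and has value y there.

mutual

  data _⊢_[_]⇓_ (X : Pred ℕ ℓ) : Code n → Vec ℕ n → ℕ → Set ℓ where
    zero   : {xs : Vec ℕ n} → X ⊢ zero [ xs ]⇓ 0
    succ   : ∀ {x} → X ⊢ succ [ x ∷ [] ]⇓ suc x
    oracle : ∀ {x y} → χ X x y → X ⊢ oracle [ x ∷ [] ]⇓ y
    proj   : {xs : Vec ℕ n} (i : Fin n) → X ⊢ proj i [ xs ]⇓ lookup xs i
    comp   : {f : Code m} {gs : Vec (Code n) m} {xs : Vec ℕ n} {ys : Vec ℕ m} {z : ℕ} →
             X ⊢ gs [ xs ]⇓* ys → X ⊢ f [ ys ]⇓ z →
             X ⊢ comp f gs [ xs ]⇓ z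
    prec-0 : {f : Code n} {g : Code (suc (suc n))} {xs : Vec ℕ n} {y : ℕ} →
             X ⊢ f [ xs ]⇓ y →
             X ⊢ prec f g [ 0 ∷ xs ]⇓ y
    prec-s : {f : Code n} {g : Code (suc (suc n))} {xs : Vec ℕ n} {k r y : ℕ} →
             X ⊢ prec f g [ k ∷ xs ]⇓ r → X ⊢ g [ k ∷ r ∷ xs ]⇓ y →
             X ⊢ prec f g [ suc k ∷ xs ]⇓ y
    mu     : {f : Code (suc n)} {xs : Vec ℕ n} {y : ℕ} →
             (∀ i → i < y → ∃ λ k → X ⊢ f [ i ∷ xs ]⇓ suc k) →
             X ⊢ f [ y ∷ xs ]⇓ 0 →
             X ⊢ mu f [ xs ]⇓ y

  data _⊢_[_]⇓*_ (X : Pred ℕ ℓ) : Vec (Code n) m → Vec ℕ n → Vec ℕ m → Set ℓ where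
    []  : {xs : Vec ℕ n} → X ⊢ [] [ xs ]⇓* []
    _∷_ : {g : Code n} {gs : Vec (Code n) m} {xs : Vec ℕ n} {y : ℕ} {ys : Vec ℕ m} →
          X ⊢ g [ xs ]⇓ y → X ⊢ gs [ xs ]⇓* ys →
          X ⊢ g ∷ gs [ xs ]⇓* (y ∷ ys)

χ-functional : {A : Set a} {P : Pred A p} {x : A} {y z : ℕ} →
               χ P x y → χ P x z → y ≡ z
χ-functional (in-set _)  (in-set _)  = refl
χ-functional (in-set h)  (out-set k) = contradiction h k
χ-functional (out-set h) (in-set k)  = contradiction k h
χ-functional (out-set _) (out-set _) = refl

mutual

  ⇓-functional : {X : Pred ℕ ℓ} {c : Code n} {xs : Vec ℕ n} {y z : ℕ} →
                 X ⊢ c [ xs ]⇓ y → X ⊢ c [ xs ]⇓ z → y ≡ z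
  ⇓-functional zero zero = refl
  ⇓-functional succ succ = refl
  ⇓-functional (oracle q) (oracle r) = χ-functional q r
  ⇓-functional (proj i) (proj .i) = refl
  ⇓-functional (comp ds d) (comp es e) with refl ← ⇓*-functional ds es = ⇓-functional d e
  ⇓-functional (prec-0 d) (prec-0 e) = ⇓-functional d e
  ⇓-functional (prec-s d d′) (prec-s e e′) with refl ← ⇓-functional d e = ⇓-functional d′ e′
  ⇓-functional (mu {y = y} below d) (mu {y = z} below′ e) with <-cmp y z
  ... | tri< y<z _ _ = contradiction (⇓-functional d (proj₂ (below′ y y<z))) 0≢1+n
  ... | tri≈ _ y≡z _ = y≡z
  ... | tri> _ _ z<y = contradiction (⇓-functional (proj₂ (below z z<y)) e) 1+n≢0

  ⇓*-functional : {X : Pred ℕ ℓ} {cs : Vec (Code n) m} {xs : Vec ℕ n} {ys zs : Vec ℕ m} →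
                  X ⊢ cs [ xs ]⇓* ys → X ⊢ cs [ xs ]⇓* zs → ys ≡ zs
  ⇓*-functional [] [] = refl
  ⇓*-functional (d ∷ ds) (e ∷ es)
    with refl ← ⇓-functional d e | refl ← ⇓*-functional ds es = refl

Computable₂ : Pred ℕ ℓ → (ℕ → ℕ → ℕ) → Set ℓ
Computable₂ X ψ = ∃ λ (c : Code 2) → ∀ n m → X ⊢ c [ n ∷ m ∷ [] ]⇓ ψ n m

ComputableSet : Pred ℕ ℓ → Pred ℕ p → Set (ℓ ⊔ p)
ComputableSet X P = ∃ λ (c : Code 1) → ∀ n k → χ P n k → X ⊢ c [ n ∷ [] ]⇓ k

ComputableSet₂ : Pred ℕ ℓ → Pred (ℕ × ℕ) p → Set (ℓ ⊔ p)
ComputableSet₂ X P =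
  ∃ λ (c : Code 2) → ∀ n m k → χ P (n , m) k → X ⊢ c [ n ∷ m ∷ [] ]⇓ k

infix 4 _≤T_ _<T_

_≤T_ : Pred ℕ ℓ → Pred ℕ p → Set (ℓ ⊔ p)
X ≤T Y = ComputableSet Y X

_<T_ : Pred ℕ ℓ → Pred ℕ p → Set (ℓ ⊔ p)
X <T Y = X ≤T Y × ¬ (Y ≤T X)

-- The inverse of Cantor's pairing function, walking along the antidiagonals:
-- (0,0), (1,0), (0,1), (2,0), (1,1), (0,2), …

unpair : ℕ → ℕ × ℕ
unpair zero    = 0 , 0
unpair (suc e) with unpair e
... | zero  , y = suc y , 0
... | suc x , y = x , suc y

-- A Gödel numbering of codes: e is read as a pair (tag , argument), and numbers
-- that are not well formed denote the constant zero. The first argument of decode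
-- bounds the nesting depth. The number of an immediate subcode of the code with
-- number e > 0 is less than e, so the bound e used in φ does not cut anything off,
-- and φ reaches every unary code.

mutual

  decode : ℕ → (n : ℕ) → ℕ → Code n
  decode zero    n e = zero
  decode (suc b) n e = decode′ b (proj₁ (unpair e)) n (proj₂ (unpair e))

  decode′ : ℕ → (tag n arg : ℕ) → Code n
  decode′ b 1 1       r = succ
  decode′ b 2 1       r = oracle
  decode′ b 3 (suc n) r = proj (r mod suc n)
  decode′ b 4 n       r = let (m , s) = unpair r
                              (f , gs) = unpair s
                          in comp (decode b m f) (decode* b n m gs)
  decode′ b 5 (suc n) r = let (f , g) = unpair r
                          in prec (decode b n f) (decode b (suc (suc n)) g)
  decode′ b 6 n       r = mu (decode b (suc n) r)
  decode′ b _ n       r = zero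

  decode* : ℕ → (n m : ℕ) → ℕ → Vec (Code n) m
  decode* b n zero    e = []
  decode* b n (suc m) e = let (c , cs) = unpair e
                          in decode b n c ∷ decode* b n m cs

φ : ℕ → Code 1
φ e = decode e 1 e

-- Equality on the underlying set is that of a setoid, and partial application
-- is given by its graph: a · b ↦ c says that ab is defined and equals c.

record PAS c ℓ r : Set (lsuc (c ⊔ ℓ ⊔ r)) where
  field
    carrier : Setoid c ℓ
  open Setoid carrier public using (Carrier; _≈_)
  field
    _·_↦_      : Carrier → Carrier → Carrier → Set r
    respects   : ∀ {a a′ b b′ v v′} → a ≈ a′ → b ≈ b′ → v ≈ v′ →
                 a · b ↦ v → a′ · b′ ↦ v′
    functional : ∀ {a b v w} → a · b ↦ v → a · b ↦ w → v ≈ w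

  infixl 7 _∙_
  infix  4 _⇓_ _≃_
  infix  5 _↓

  data Term : Set c where
    ⌜_⌝ : Carrier → Term
    _∙_ : Term → Term → Term

  data _⇓_ : Term → Carrier → Set (c ⊔ ℓ ⊔ r) where
    const : ∀ {a v} → a ≈ v → ⌜ a ⌝ ⇓ v
    apply : ∀ {t u a b v} → t ⇓ a → u ⇓ b → a · b ↦ v → t ∙ u ⇓ v

  _↓ : Term → Set (c ⊔ ℓ ⊔ r)
  t ↓ = ∃ λ v → t ⇓ v

  _≃_ : Term → Term → Set (c ⊔ ℓ ⊔ r)
  t ≃ u = ∀ v → t ⇓ v ⇔ u ⇓ v

record IsPCA {c ℓ r} (𝒜 : PAS c ℓ r) : Set (c ⊔ ℓ ⊔ r) where
  open PAS 𝒜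
  field
    k s        : Carrier
    k-defined  : ∀ a → ⌜ k ⌝ ∙ ⌜ a ⌝ ↓
    k-equation : ∀ a b → ⌜ k ⌝ ∙ ⌜ a ⌝ ∙ ⌜ b ⌝ ⇓ a
    s-defined  : ∀ a b → ⌜ s ⌝ ∙ ⌜ a ⌝ ∙ ⌜ b ⌝ ↓
    s-equation : ∀ a b c → ⌜ s ⌝ ∙ ⌜ a ⌝ ∙ ⌜ b ⌝ ∙ ⌜ c ⌝
                           ≃ ⌜ a ⌝ ∙ ⌜ c ⌝ ∙ (⌜ b ⌝ ∙ ⌜ c ⌝)
    nontrivial : ∃₂ λ a b → ¬ (a ≈ b)

record IsCombinatoryAlgebra {c ℓ r} (𝒜 : PAS c ℓ r) : Set (c ⊔ ℓ ⊔ r) where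
  open PAS 𝒜
  field
    isPCA : IsPCA 𝒜
    total : ∀ a b → ⌜ a ⌝ ∙ ⌜ b ⌝ ↓

record CombinatoryAlgebra c ℓ r : Set (lsuc (c ⊔ ℓ ⊔ r)) where
  field
    pas                  : PAS c ℓ r
    isCombinatoryAlgebra : IsCombinatoryAlgebra pas
  open PAS pas public
  open IsCombinatoryAlgebra isCombinatoryAlgebra public

record IsComputable {y c ℓ r} (Y : Pred ℕ y) (𝒜 : CombinatoryAlgebra c ℓ r)
       : Set (y ⊔ c ⊔ ℓ ⊔ r) where
  open CombinatoryAlgebra 𝒜
  field
    numbering : Surjection (setoid ℕ) carrier
  open Surjection numbering public using () renaming (to to γ)
  field
    ψ            : ℕ → ℕ → ℕ
    ψ-computable : Computable₂ Y ψ
    ψ-represents : ∀ n m → γ n · γ m ↦ γ (ψ n m)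
    ≈-computable : ComputableSet₂ Y (λ (n , m) → γ n ≈ γ m)

record WeakEmbedding {c ℓ r c′ ℓ′ r′} (𝒜 : PAS c ℓ r) (ℬ : PAS c′ ℓ′ r′)
       : Set (c ⊔ ℓ ⊔ r ⊔ c′ ⊔ ℓ′ ⊔ r′) where
  private
    module 𝒜 = PAS 𝒜
    module ℬ = PAS ℬ
  field
    injection : Injection 𝒜.carrier ℬ.carrier
  open Injection injection public using () renaming (to to f)
  field
    preserves : ∀ {a b v} → a 𝒜.· b ↦ v → f a ℬ.· f b ↦ f v

K₁ : Pred ℕ ℓ → PAS 0ℓ 0ℓ ℓ
K₁ X = record
  { carrier    = setoid ℕ
  ; _·_↦_      = λ e x y → X ⊢ φ e [ x ∷ [] ]⇓ y
  ; respects   = λ { refl refl refl d → d }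
  ; functional = ⇓-functional
  }

{-# OPTIONS --safe #-}

-- Iterating application of the image of a code for the successor shows that a
-- γ-index num n of f n is Y-computable in n. Hence X ≤T Y: with x a code for the
-- oracle, n ∈ X iff f x · f n = f 1, and equality in 𝒜 is Y-decidable.
--
-- If also Y ≤T X, then the set { n | γ n · f n = f 0 } is X-decidable, say by the
-- code e. Let i be an index of f e. Then γ i · f i = f (e · i), so e · i = 1 says
-- f 1 = f 0 and e · i = 0 says f 0 ≠ f 0. Totality of application in 𝒜 makes this
-- diagonal set decidable without any appeal to a universal machine.

module Submission where

open import Data.Empty using (⊥)
open import Data.Fin.Base using (Fin; zero; suc; toℕ)
open import Data.Fin.Properties using (toℕ<n; toℕ-fromℕ<; toℕ-injective)
open import Data.Nat.Base using (ℕ; zero; suc; _+_; _≤_; z≤n; s≤s)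
open import Data.Nat.DivMod using (_mod_; m<n⇒m%n≡m)
open import Data.Nat.Properties
  using (+-identityʳ; +-suc; ≤-refl; ≤-trans; ≤-reflexive; m≤m+n; m≤n+m)
open import Data.Product.Base using (∃; _,_; proj₁; proj₂)
open import Data.Vec.Base using (Vec; []; _∷_)
open import Function.Bundles using (Injection; Surjection)
open import Level using (Level)
open import Relation.Binary.Bundles using (Setoid)
open import Relation.Binary.PropositionalEquality
  using (_≡_; refl; sym; trans; cong; cong₂; subst)
open import Relation.Nullary using (¬_; contradiction)
open import Relation.Unary using (Pred)
open import Defs

private variable
  a ℓ p : Level
  m n : ℕ

-- Membership in `P` may be undecidable in Agda, so a characteristic value exists only up to double
-- negation. This suffices for the diagonal argument, whose goal is a contradiction.
χ-¬¬defined : {A : Set a} (P : Pred A p) (x : A) → ¬ ¬ ∃ (χ P x)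
χ-¬¬defined P x undefined = undefined (0 , out-set λ h → undefined (1 , in-set h))

-- Otherwise the type checker evaluates the (huge) Gödel numbers of concrete codes.
abstract
  unpair-surjective : ∀ x y → ∃ λ e → unpair e ≡ (x , y)
  unpair-surjective x y = antidiagonal (x + y) y x refl
    where
    -- Walk the enumeration backwards: `(x , suc y)` is preceded by `(suc x , y)`, and `(suc x , 0)`
    -- by `(0 , x)`, the end of the previous antidiagonal. The recursion is lexicographic in `s` and
    -- `y`.
    antidiagonal : ∀ s y x → x + y ≡ s → ∃ λ e → unpair e ≡ (x , y)
    antidiagonal s (suc y) x eq
      with e , q ← antidiagonal s y (suc x) (trans (sym (+-suc x y)) eq)
      = suc e , step e q
      where
      step : ∀ e → unpair e ≡ (suc x , y) → unpair (suc e) ≡ (x , suc y)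
      step e q rewrite q = refl
    antidiagonal zero zero zero _ = 0 , refl
    antidiagonal (suc s) zero (suc x) eq
      with e , q ← antidiagonal s s zero refl
      = suc e , step e q eq
      where
      step : ∀ e → unpair e ≡ (0 , s) → suc x + 0 ≡ suc s → unpair (suc e) ≡ (suc x , 0)
      step e q eq rewrite q = cong (_, 0) (trans (sym eq) (+-identityʳ (suc x)))

unpair-sum-≤ : ∀ e → proj₁ (unpair e) + proj₂ (unpair e) ≤ e
unpair-sum-≤ zero = z≤n
unpair-sum-≤ (suc e) with unpair e | unpair-sum-≤ e
... | zero  , y | le = s≤s (≤-trans (≤-reflexive (+-identityʳ y)) le)
... | suc x , y | le = ≤-trans (≤-reflexive (+-suc x y)) (≤-trans le (m≤n+m e 1))

pair : ℕ → ℕ → ℕ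
pair x y = proj₁ (unpair-surjective x y)

unpair-pair : ∀ x y → unpair (pair x y) ≡ (x , y)
unpair-pair x y = proj₂ (unpair-surjective x y)

pair-sum-≤ : ∀ x y → x + y ≤ pair x y
pair-sum-≤ x y =
  subst (λ q → proj₁ q + proj₂ q ≤ pair x y) (unpair-pair x y) (unpair-sum-≤ (pair x y))

toℕ-mod : (i : Fin (suc n)) → toℕ i mod suc n ≡ i
toℕ-mod i = toℕ-injective (trans (toℕ-fromℕ< _) (m<n⇒m%n≡m (toℕ<n i)))

-- A positive tag makes `r` strictly smaller than the paired number, so after `decode` spends one
-- unit of its bound, what remains still dominates `r`.
decode-pair : ∀ tag r (c : Code n) →
              (∀ {b} → r ≤ b → decode′ b (suc tag) n r ≡ c) →
              ∀ {b} → pair (suc tag) r ≤ b → decode b n (pair (suc tag) r) ≡ c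
decode-pair tag r c h {zero} le with () ← ≤-trans (pair-sum-≤ (suc tag) r) le
decode-pair tag r c h {suc b} le
  rewrite unpair-pair (suc tag) r
  with s≤s le′ ← ≤-trans (pair-sum-≤ (suc tag) r) le
  = h (≤-trans (m≤n+m r tag) le′)

pair-≤ˡ : ∀ x y {b} → pair x y ≤ b → x ≤ b
pair-≤ˡ x y le = ≤-trans (m≤m+n x y) (≤-trans (pair-sum-≤ x y) le)

pair-≤ʳ : ∀ x y {b} → pair x y ≤ b → y ≤ b
pair-≤ʳ x y le = ≤-trans (m≤n+m y x) (≤-trans (pair-sum-≤ x y) le)

encode : Code n → ℕ
encode* : Vec (Code n) m → ℕ
encode zero                = 0
encode succ                = pair 1 0
encode oracle              = pair 2 0
encode (proj i)            = pair 3 (toℕ i)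
encode (comp {m = m} f gs) = pair 4 (pair m (pair (encode f) (encode* gs)))
encode (prec f g)          = pair 5 (pair (encode f) (encode g))
encode (mu f)              = pair 6 (encode f)
encode* []       = 0
encode* (c ∷ cs) = pair (encode c) (encode* cs)

-- The bound `b` is arbitrary because a subcode is decoded with the bound left over from its parent,
-- which may exceed its own number.
decode-encode : (c : Code n) → ∀ {b} → encode c ≤ b → decode b n (encode c) ≡ c
decode*-encode* : (cs : Vec (Code n) m) → ∀ {b} → encode* cs ≤ b →
                  decode* b n m (encode* cs) ≡ cs
-- An exhausted bound yields `zero`; otherwise `unpair 0` has tag 0, which the catch-all clause of
-- `decode′` also reads as `zero`.
decode-encode zero {zero}  _ = refl
decode-encode zero {suc b} _ = refl
decode-encode succ   = decode-pair 0 0 succ λ _ → refl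
decode-encode oracle = decode-pair 1 0 oracle λ _ → refl
decode-encode {suc n} (proj i) = decode-pair 2 (toℕ i) (proj i) λ _ → cong proj (toℕ-mod i)
decode-encode {n} (comp {m = m} f gs) = decode-pair 3 r (comp f gs) decode-args
  where
  s = pair (encode f) (encode* gs)
  r = pair m s
  decode-args : ∀ {b} → r ≤ b → decode′ b 4 n r ≡ comp f gs
  decode-args le
    rewrite unpair-pair m s | unpair-pair (encode f) (encode* gs)
    = cong₂ comp (decode-encode f (pair-≤ˡ (encode f) (encode* gs) le′))
                 (decode*-encode* gs (pair-≤ʳ (encode f) (encode* gs) le′))
    where le′ = pair-≤ʳ m s le
decode-encode {suc n} (prec f g) = decode-pair 4 r (prec f g) decode-args
  where
  r = pair (encode f) (encode g)
  decode-args : ∀ {b} → r ≤ b → decode′ b 5 (suc n) r ≡ prec f g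
  decode-args le
    rewrite unpair-pair (encode f) (encode g)
    = cong₂ prec (decode-encode f (pair-≤ˡ (encode f) (encode g) le))
                 (decode-encode g (pair-≤ʳ (encode f) (encode g) le))
decode-encode (mu f) = decode-pair 5 (encode f) (mu f) λ le → cong mu (decode-encode f le)
decode*-encode* [] _ = refl
decode*-encode* (c ∷ cs) le
  rewrite unpair-pair (encode c) (encode* cs)
  = cong₂ _∷_ (decode-encode c (pair-≤ˡ (encode c) (encode* cs) le))
              (decode*-encode* cs (pair-≤ʳ (encode c) (encode* cs) le))

φ-encode : (c : Code 1) → φ (encode c) ≡ c
φ-encode c = decode-encode c ≤-refl

K₁-apply : (X : Pred ℕ ℓ) (c : Code 1) {x y : ℕ} → X ⊢ c [ x ∷ [] ]⇓ y →
           PAS._·_↦_ (K₁ X) (encode c) x y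
K₁-apply X c {x} {y} = subst (λ d → X ⊢ d [ x ∷ [] ]⇓ y) (sym (φ-encode c))

constant : ℕ → Code n
constant zero    = zero
constant (suc k) = comp succ (constant k ∷ [])

constant-⇓ : {X : Pred ℕ ℓ} (k : ℕ) {xs : Vec ℕ n} → X ⊢ constant k [ xs ]⇓ k
constant-⇓ zero    = zero
constant-⇓ (suc k) = comp (constant-⇓ k ∷ []) succ

substOracle : Code 1 → Code n → Code n
substOracle* : Code 1 → Vec (Code n) m → Vec (Code n) m
substOracle d zero        = zero
substOracle d succ        = succ
substOracle d oracle      = d
substOracle d (proj i)    = proj i
substOracle d (comp f gs) = comp (substOracle d f) (substOracle* d gs)
substOracle d (prec f g)  = prec (substOracle d f) (substOracle d g)
substOracle d (mu f)      = mu (substOracle d f)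
substOracle* d []       = []
substOracle* d (c ∷ cs) = substOracle d c ∷ substOracle* d cs

module _ {X : Pred ℕ ℓ} {Y : Pred ℕ p} (Y≤X : Y ≤T X) where

  -- Induction on the computation: each oracle answer is itself a characteristic value of `Y`, and
  -- the reduction turns exactly that value into a computation from `X`.
  substOracle-⇓ : {c : Code n} {xs : Vec ℕ n} {z : ℕ} →
                  Y ⊢ c [ xs ]⇓ z → X ⊢ substOracle (proj₁ Y≤X) c [ xs ]⇓ z
  substOracle*-⇓ : {cs : Vec (Code n) m} {xs : Vec ℕ n} {zs : Vec ℕ m} →
                   Y ⊢ cs [ xs ]⇓* zs → X ⊢ substOracle* (proj₁ Y≤X) cs [ xs ]⇓* zs
  substOracle-⇓ zero = zero
  substOracle-⇓ succ = succ
  substOracle-⇓ (oracle q) = proj₂ Y≤X _ _ q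
  substOracle-⇓ (proj i) = proj i
  substOracle-⇓ (comp gs⇓ f⇓) = comp (substOracle*-⇓ gs⇓) (substOracle-⇓ f⇓)
  substOracle-⇓ (prec-0 f⇓) = prec-0 (substOracle-⇓ f⇓)
  substOracle-⇓ (prec-s r⇓ g⇓) = prec-s (substOracle-⇓ r⇓) (substOracle-⇓ g⇓)
  substOracle-⇓ (mu below f⇓) =
    mu (λ i i<y → let (k , e) = below i i<y in k , substOracle-⇓ e) (substOracle-⇓ f⇓)
  substOracle*-⇓ [] = []
  substOracle*-⇓ (c⇓ ∷ cs⇓) = substOracle-⇓ c⇓ ∷ substOracle*-⇓ cs⇓

module _ {x y c ℓ r} (X : Pred ℕ x) (Y : Pred ℕ y) (𝒜 : CombinatoryAlgebra c ℓ r)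
         (computable : IsComputable Y 𝒜)
         (embedding : WeakEmbedding (K₁ X) (CombinatoryAlgebra.pas 𝒜)) where

  open CombinatoryAlgebra 𝒜
  open IsComputable computable
  open WeakEmbedding embedding
  open Setoid carrier using () renaming (sym to ≈-sym; trans to ≈-trans; refl to ≈-refl)

  index : Carrier → ℕ
  index = Surjection.to⁻ numbering

  γ-index : ∀ v → γ (index v) ≈ v
  γ-index = Surjection.to∘to⁻ numbering

  f-injective : ∀ {k l} → f k ≈ f l → k ≡ l
  f-injective = Injection.injective injection

  ψ-code : Code 2
  ψ-code = proj₁ ψ-computable

  -- The same product in `𝒜` is evaluated twice, through the numbering and through the embedding;
  -- functionality of application identifies the results.
  γ-ψ : ∀ c {n i k z} → γ i ≈ f (encode c) → γ n ≈ f k → X ⊢ c [ k ∷ [] ]⇓ z →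
        γ (ψ i n) ≈ f z
  γ-ψ c {n} {i} γi γn d =
    functional (respects γi γn ≈-refl (ψ-represents i n)) (preserves (K₁-apply X c d))

  -- The map sending `n` to `index (f n)` carries no effectivity. Here only two values of `index`
  -- enter, and they can be hard-wired into a code.
  num : ℕ → ℕ
  num zero    = index (f 0)
  num (suc n) = ψ (index (f (encode succ))) (num n)

  γ-num : ∀ n → γ (num n) ≈ f n
  γ-num zero    = γ-index (f 0)
  γ-num (suc n) = γ-ψ succ (γ-index _) (γ-num n) succ

  num-code : Code 1
  num-code = prec (constant (num 0))
                  -- The step of `prec` receives the counter and then the previous value;
                  -- `proj (suc zero)` selects the latter.
                  (comp ψ-code (constant (index (f (encode succ))) ∷ proj (suc zero) ∷ []))

  num-code-⇓ : ∀ n → Y ⊢ num-code [ n ∷ [] ]⇓ num n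
  num-code-⇓ zero    = prec-0 (constant-⇓ (num 0))
  num-code-⇓ (suc n) = prec-s (num-code-⇓ n)
    (comp (constant-⇓ _ ∷ proj (suc zero) ∷ []) (proj₂ ψ-computable _ _))

  -- If `g` sends `n` to `i`, this decides whether `γ i` applied to `f n` is `f j`. A constant `g`
  -- gives the reduction of `X` to `Y`, the identity gives the diagonal set.
  valueTest : Code 1 → ℕ → Code 1
  valueTest g j =
    comp (proj₁ ≈-computable) (comp ψ-code (g ∷ num-code ∷ []) ∷ constant (num j) ∷ [])

  valueTest-⇓ : ∀ {g i} j n {k} → Y ⊢ g [ n ∷ [] ]⇓ i →
                χ (λ (a , b) → γ a ≈ γ b) (ψ i (num n) , num j) k →
                Y ⊢ valueTest g j [ n ∷ [] ]⇓ k
  valueTest-⇓ j n g⇓ q =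
    comp (comp (g⇓ ∷ num-code-⇓ n ∷ []) (proj₂ ψ-computable _ _) ∷ constant-⇓ (num j) ∷ [])
         (proj₂ ≈-computable _ _ _ q)

  X≤TY : X ≤T Y
  X≤TY = valueTest (constant i) 1 , λ n k q → valueTest-⇓ 1 n (constant-⇓ i) (reflect q)
    where
    i = index (f (encode oracle))
    -- The oracle answer at `n` appears in `𝒜` as `f 1` or `f 0`; injectivity of `f` keeps these
    -- apart, so comparison with `f 1` returns the answer itself.
    reflect : ∀ {n k} → χ X n k → χ (λ (a , b) → γ a ≈ γ b) (ψ i (num n) , num 1) k
    reflect {n} q@(in-set _) =
      in-set (≈-trans (γ-ψ oracle (γ-index _) (γ-num n) (oracle q)) (≈-sym (γ-num 1)))
    reflect {n} q@(out-set _) = out-set λ eq →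
      contradiction
        (f-injective (≈-trans (≈-sym (γ-ψ oracle (γ-index _) (γ-num n) (oracle q)))
                              (≈-trans eq (γ-num 1))))
        λ ()

  Y≰TX : ¬ (Y ≤T X)
  -- Assume a value `k` of the diagonal set at `i`. It is computed from `Y`, transferred to `X`, and
  -- read in `𝒜` as `γ (ψ i (num i)) ≈ f k`.
  Y≰TX Y≤X = χ-¬¬defined _ _ λ (_ , q) → absurd q (γ-ψ diagonal (γ-index _) (γ-num i)
                 (substOracle-⇓ Y≤X (valueTest-⇓ 0 i (proj zero) q)))
    where
    diagonal = substOracle (proj₁ Y≤X) (valueTest (proj zero) 0)
    i = index (f (encode diagonal))
    absurd : ∀ {k} → χ (λ (a , b) → γ a ≈ γ b) (ψ i (num i) , num 0) k →
             γ (ψ i (num i)) ≈ f k → ⊥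
    absurd (in-set eq) eq′ =
      contradiction (f-injective (≈-trans (≈-sym eq′) (≈-trans eq (γ-num 0)))) λ ()
    absurd (out-set neq) eq′ = neq (≈-trans eq′ (≈-sym (γ-num 0)))

theorem5p2 : ∀ {x y c ℓ r} (X : Pred ℕ x) (Y : Pred ℕ y)
    (𝒜 : CombinatoryAlgebra c ℓ r) → IsComputable Y 𝒜 →
    WeakEmbedding (K₁ X) (CombinatoryAlgebra.pas 𝒜) → X <T Y
theorem5p2 X Y 𝒜 computable embedding =
  X≤TY X Y 𝒜 computable embedding , Y≰TX X Y 𝒜 computable embedding
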